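{- Let $F$ be a Boolean formula in conjunctive normal form with (finite) variable set $V$. For a valid partial assignment $\boldsymbol{b}$ of $F$, let $S(\boldsymbol{b})$ and $U(\boldsymbol{b})$ denote the sets of star and unconstrained variables of $\boldsymbol{b}$ in $F$, respectively. Let $p_i$ and $q_i$ ($i \in V$) be real numbers such that $p_i + q_i = 1$ for all $i \in V$. Then, for any satisfying assignment $\boldsymbol{a} \in \{0,1\}^V$ of $F$, $$\sum_{\boldsymbol{b} \leq \boldsymbol{a}} \ \prod_{i \in S(\boldsymbol{b})} p_i \prod_{j \in U(\boldsymbol{b})} q_j = 1,$$ where the sum is over all valid partial assignments $\boldsymbol{b}$ of $F$ with $\boldsymbol{b} \leq \boldsymbol{a}$ in the poset $P(F)$.
   Context: $F$ is a conjunction of finitely many clauses; each clause is a disjunction of finitely many distinct literals, where a literal is a variable of $V$ or its negation. A partial assignment is an element $\boldsymbol{x} \in \{0, 1, *\}^V$, where $*$ means unassigned. Plugging $\boldsymbol{x}$ into a clause gives each literal a value: a literal on a variable with value $*$ gets the value $*$, and otherwise literals are evaluated as usual. $\boldsymbol{x}$ is invalid for a clause if either all literals of the clause get value $0$, or exactly one literal gets value $*$ and all other literals get value $0$. $\boldsymbol{x}$ is valid for $F$ if it is not invalid for any clause of $F$. In particular, an assignment in $\{0,1\}^V$ is valid if and only if it satisfies $F$. The poset $P(F)$ has as elements the valid partial assignments of $F$, where $\boldsymbol{a}$ covers $\boldsymbol{b}$ if $\boldsymbol{b}$ is obtained from $\boldsymbol{a}$ by switching exactly one coordinate with value $0$ or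 $1$ to $*$; the order $\leq$ is the reflexive transitive closure of this relation (so all intermediate partial assignments must be valid). For a valid partial assignment $\boldsymbol{b}$, a variable $i \in V$ is a star variable if $b_i = *$. It is unconstrained if $b_i \in \{0, 1\}$ and changing $b_i$ to $*$ gives a valid partial assignment. -}

module Defs where

open import Algebra.Bundles using (CommutativeRing)
open import Data.Bool using (Bool; true; false; not)
open import Data.Fin using (Fin; zero; suc)
open import Data.Fin.Properties using (any?) renaming (_≟_ to _≟ᶠ_)
open import Data.Irrelevant using ([_])
open import Data.List using (List; []; _∷_; foldr; filter; mapMaybe; allFin; cartesianProductWith)
open import Data.List.Relation.Unary.All as All using (All)
open import Data.List.Relation.Unary.Any as Any using (Any)
open import Data.List.Relation.Unary.Unique.Propositional using (Unique)
open import Data.Maybe as Maybe using (Maybe; just; nothing; Is-just)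
open import Data.Maybe.Properties using () renaming (≡-dec to Maybe-≡-dec)
import Data.Maybe.Relation.Unary.Any as MaybeAny
open import Data.Nat as ℕ using (ℕ; zero; suc)
import Data.Nat.Properties as ℕ
open import Data.Nat.Induction using (<-wellFounded)
open import Data.Product using (Σ; ∃-syntax; _×_; _,_)
open import Data.Rational as ℚ using (ℚ; 0ℚ; 1ℚ; ½; ∣_∣; 1/_)
import Data.Rational.Properties as ℚ
open import Data.Rational.Solver using (module +-*-Solver)
open import Data.Refinement using (Refinement; value; _,_) renaming (_≟_ to Refinement-≟)
open import Data.Sum using (_⊎_; inj₁; inj₂)
open import Data.Vec as Vec using (Vec; []; _∷_; lookup; _[_]≔_)
open import Data.Vec.Properties using (lookup-map) renaming (≡-dec to Vec-≡-dec)
open import Data.Bool.Properties using () renaming (_≟_ to _≟ᵇ_)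
open import Induction.WellFounded using (Acc; acc)
open import Level using (0ℓ)
open import Relation.Binary using (DecidableEquality)
open import Relation.Binary.Construct.Closure.ReflexiveTransitive using (Star; ε; _◅_)
open import Relation.Binary.PropositionalEquality
  using (_≡_; _≢_; refl; sym; trans; cong; subst; subst₂)
open import Relation.Nullary using (¬_; Dec; yes; no; ¬?; contradiction-irr)
open import Relation.Nullary.Decidable using (_×-dec_; _⊎-dec_; _→-dec_; map′)
open import Relation.Unary using (Decidable)

-- The standard library has no real numbers; these are Cauchy sequences of
-- rationals, with equality given by the setoid relation _≈_.

module Real where

  Seq : Set
  Seq = ℕ → ℚ

  -- Between Cauchy sequences this says that  x n - y n  tends to 0.
  -- The two independent indices make "x is Cauchy" the instance x ∼ x.
  infix 4 _∼_
  record _∼_ (x y : Seq) : Set where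
    constructor close
    field
      within : ∀ δ → 0ℚ ℚ.< δ →
        ∃[ N ] (∀ m n → N ℕ.≤ m → N ℕ.≤ n → ∣ x m ℚ.- y n ∣ ℚ.< δ)
  open _∼_ public

  Cauchy : Seq → Set
  Cauchy x = x ∼ x

  record ℝ : Set where
    constructor mkℝ
    field
      seq    : Seq
      cauchy : Cauchy seq
  open ℝ public

  infix 4 _≈_
  _≈_ : ℝ → ℝ → Set
  x ≈ y = seq x ∼ seq y

  private
    telescope : ∀ a b c → a ℚ.- c ≡ (a ℚ.- b) ℚ.+ (b ℚ.- c)
    telescope = solve 3 (λ a b c → a :- c := (a :- b) :+ (b :- c)) refl
      where open +-*-Solver

    difference-+ : ∀ a b c d → (a ℚ.+ b) ℚ.- (c ℚ.+ d) ≡ (a ℚ.- c) ℚ.+ (b ℚ.- d)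
    difference-+ = solve 4 (λ a b c d → (a :+ b) :- (c :+ d) := (a :- c) :+ (b :- d)) refl
      where open +-*-Solver

    difference-* : ∀ a b c d → a ℚ.* b ℚ.- c ℚ.* d ≡ a ℚ.* (b ℚ.- d) ℚ.+ d ℚ.* (a ℚ.- c)
    difference-* = solve 4 (λ a b c d → a :* b :- c :* d := a :* (b :- d) :+ d :* (a :- c)) refl
      where open +-*-Solver

    difference-neg : ∀ a b → b ℚ.- a ≡ (ℚ.- a) ℚ.- (ℚ.- b)
    difference-neg = solve 2 (λ a b → b :- a := (:- a) :- (:- b)) refl
      where open +-*-Solver

    add-back : ∀ a b → (a ℚ.- b) ℚ.+ b ≡ a
    add-back = solve 2 (λ a b → (a :- b) :+ b := a) refl
      where open +-*-Solver

    negated : ∀ a b → a ℚ.- b ≡ ℚ.- (b ℚ.- a)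
    negated = solve 2 (λ a b → a :- b := :- (b :- a)) refl
      where open +-*-Solver

    half>0 : ∀ {δ} → 0ℚ ℚ.< δ → 0ℚ ℚ.< ½ ℚ.* δ
    half>0 {δ} δ>0 = subst (ℚ._< ½ ℚ.* δ) (ℚ.*-zeroʳ ½) (ℚ.*-monoʳ-<-pos ½ δ>0)

    half+half : ∀ δ → ½ ℚ.* δ ℚ.+ ½ ℚ.* δ ≡ δ
    half+half δ = trans (sym (ℚ.*-distribʳ-+ δ ½ ½)) (ℚ.*-identityˡ δ)

    split : ∀ {a b c δ} → a ≡ b ℚ.+ c →
            ∣ b ∣ ℚ.< ½ ℚ.* δ → ∣ c ∣ ℚ.< ½ ℚ.* δ → ∣ a ∣ ℚ.< δ
    split {b = b} {c} {δ} refl b< c< = subst (∣ b ℚ.+ c ∣ ℚ.<_) (half+half δ)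
      (ℚ.≤-<-trans (ℚ.∣p+q∣≤∣p∣+∣q∣ b c) (ℚ.+-mono-< b< c<))

    ∣-∣-swap : ∀ a b → ∣ a ℚ.- b ∣ ≡ ∣ b ℚ.- a ∣
    ∣-∣-swap a b = trans (cong ∣_∣ (negated a b))
                         (ℚ.∣-p∣≡∣p∣ (b ℚ.- a))

    bound : ∀ {x y} → x ∼ y →
            ∃[ B ] ℚ.Positive B × ∃[ N ] (∀ m → N ℕ.≤ m → ∣ x m ∣ ℚ.< B)
    bound {x} {y} x∼y with within x∼y 1ℚ (ℚ.positive⁻¹ 1ℚ)
    ... | N , h = 1ℚ ℚ.+ ∣ y N ∣ , B>0 , N , λ m N≤m →
          ℚ.≤-<-trans
            (subst (λ z → ∣ z ∣ ℚ.≤ ∣ x m ℚ.- y N ∣ ℚ.+ ∣ y N ∣) (add-back (x m) (y N))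
              (ℚ.∣p+q∣≤∣p∣+∣q∣ (x m ℚ.- y N) (y N)))
            (ℚ.+-monoˡ-< ∣ y N ∣ (h m N N≤m ℕ.≤-refl))
      where
      B>0 : ℚ.Positive (1ℚ ℚ.+ ∣ y N ∣)
      B>0 = ℚ.positive (ℚ.+-mono-<-≤ (ℚ.positive⁻¹ 1ℚ) (ℚ.0≤∣p∣ (y N)))

    scaled : ∀ B → ℚ.Positive B → ∀ {δ} → 0ℚ ℚ.< δ →
             ∃[ η ] 0ℚ ℚ.< η × (∀ {b c} → ∣ b ∣ ℚ.< B → ∣ c ∣ ℚ.< η → ∣ b ℚ.* c ∣ ℚ.< δ)
    scaled B B>0 {δ} δ>0 = η , η>0 , est
      where
      instance
        posB : ℚ.Positive B
        posB = B>0
        nzB : ℚ.NonZero B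
        nzB = ℚ.pos⇒nonZero B
        pos1/B : ℚ.Positive (1/ B)
        pos1/B = ℚ.1/pos⇒pos B
      η = 1/ B ℚ.* δ
      η>0 : 0ℚ ℚ.< η
      η>0 = subst (ℚ._< η) (ℚ.*-zeroʳ (1/ B)) (ℚ.*-monoʳ-<-pos (1/ B) δ>0)
      Bη : B ℚ.* η ≡ δ
      Bη = trans (sym (ℚ.*-assoc B (1/ B) δ))
                 (trans (cong (ℚ._* δ) (ℚ.*-inverseʳ B)) (ℚ.*-identityˡ δ))
      est : ∀ {b c} → ∣ b ∣ ℚ.< B → ∣ c ∣ ℚ.< η → ∣ b ℚ.* c ∣ ℚ.< δ
      est {b} {c} b< c< = subst₂ ℚ._<_ (sym (ℚ.∣p*q∣≡∣p∣*∣q∣ b c)) Bη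
        (ℚ.≤-<-trans
          (ℚ.*-monoʳ-≤-nonNeg ∣ c ∣ {{ℚ.∣-∣-nonNeg c}} (ℚ.<⇒≤ b<))
          (ℚ.*-monoʳ-<-pos B c<))

  ∼-sym : ∀ {x y} → x ∼ y → y ∼ x
  ∼-sym {x} {y} x∼y .within δ δ>0 with within x∼y δ δ>0
  ... | N , h = N , λ m n N≤m N≤n → subst (ℚ._< δ) (∣-∣-swap (x n) (y m)) (h n m N≤n N≤m)

  ∼-trans : ∀ {x y z} → x ∼ y → y ∼ z → x ∼ z
  ∼-trans {x} {y} {z} x∼y y∼z .within δ δ>0
    with within x∼y (½ ℚ.* δ) (half>0 {δ} δ>0) | within y∼z (½ ℚ.* δ) (half>0 {δ} δ>0)
  ... | M , h | N , k = K , λ m n K≤m K≤n →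
        split {δ = δ} (telescope (x m) (y K) (z n))
          (h m K (ℕ.≤-trans M≤K K≤m) M≤K)
          (k K n N≤K (ℕ.≤-trans N≤K K≤n))
    where
    K = M ℕ.⊔ N
    M≤K = ℕ.m≤m⊔n M N
    N≤K = ℕ.m≤n⊔m M N

  ∼-const : ∀ c → Cauchy (λ _ → c)
  ∼-const c .within δ δ>0 =
    0 , λ _ _ _ _ → subst (ℚ._< δ) (sym (cong ∣_∣ (ℚ.+-inverseʳ c))) δ>0

  ∼-pointwise : ∀ {x y z} → (∀ n → y n ≡ z n) → x ∼ y → x ∼ z
  ∼-pointwise {x} y≡z x∼y .within δ δ>0 with within x∼y δ δ>0
  ... | N , h = N , λ m n N≤m N≤n →
        subst (λ t → ∣ x m ℚ.- t ∣ ℚ.< δ) (y≡z n) (h m n N≤m N≤n)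

  +-cong : ∀ {x x′ y y′} → x ∼ x′ → y ∼ y′ →
           (λ n → x n ℚ.+ y n) ∼ (λ n → x′ n ℚ.+ y′ n)
  +-cong {x} {x′} {y} {y′} x∼ y∼ .within δ δ>0
    with within x∼ (½ ℚ.* δ) (half>0 {δ} δ>0) | within y∼ (½ ℚ.* δ) (half>0 {δ} δ>0)
  ... | M , h | N , k = M ℕ.⊔ N , λ m n K≤m K≤n →
        split {δ = δ} (difference-+ (x m) (y m) (x′ n) (y′ n))
          (h m n (ℕ.≤-trans (ℕ.m≤m⊔n M N) K≤m) (ℕ.≤-trans (ℕ.m≤m⊔n M N) K≤n))
          (k m n (ℕ.≤-trans (ℕ.m≤n⊔m M N) K≤m) (ℕ.≤-trans (ℕ.m≤n⊔m M N) K≤n))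

  neg-cong : ∀ {x x′} → x ∼ x′ → (λ n → ℚ.- x n) ∼ (λ n → ℚ.- x′ n)
  neg-cong {x} {x′} x∼ .within δ δ>0 with within x∼ δ δ>0
  ... | N , h = N , λ m n N≤m N≤n →
        subst (ℚ._< δ)
          (trans (∣-∣-swap (x m) (x′ n))
                 (cong ∣_∣ (difference-neg (x m) (x′ n))))
          (h m n N≤m N≤n)

  *-cong : ∀ {x x′ y y′} → x ∼ x′ → y ∼ y′ →
           (λ n → x n ℚ.* y n) ∼ (λ n → x′ n ℚ.* y′ n)
  *-cong {x} {x′} {y} {y′} x∼ y∼ .within δ δ>0 =
    let (B , B>0 , N₁ , xB)  = bound x∼
        (C , C>0 , N₂ , y′C) = bound (∼-sym y∼)
        (η , η>0 , estB) = scaled B B>0 (half>0 {δ} δ>0)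
        (θ , θ>0 , estC) = scaled C C>0 (half>0 {δ} δ>0)
        (N₃ , h) = within y∼ η η>0
        (N₄ , k) = within x∼ θ θ>0
        K₁ = N₁ ℕ.⊔ N₂
        K₂ = N₃ ℕ.⊔ N₄
        K  = K₁ ℕ.⊔ K₂
        N₁≤K = ℕ.≤-trans (ℕ.m≤m⊔n N₁ N₂) (ℕ.m≤m⊔n K₁ K₂)
        N₂≤K = ℕ.≤-trans (ℕ.m≤n⊔m N₁ N₂) (ℕ.m≤m⊔n K₁ K₂)
        N₃≤K = ℕ.≤-trans (ℕ.m≤m⊔n N₃ N₄) (ℕ.m≤n⊔m K₁ K₂)
        N₄≤K = ℕ.≤-trans (ℕ.m≤n⊔m N₃ N₄) (ℕ.m≤n⊔m K₁ K₂)
    in K , λ m n K≤m K≤n →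
        split (difference-* (x m) (y m) (x′ n) (y′ n))
          (estB {x m} {y m ℚ.- y′ n} (xB m (ℕ.≤-trans N₁≤K K≤m))
            (h m n (ℕ.≤-trans N₃≤K K≤m) (ℕ.≤-trans N₃≤K K≤n)))
          (estC {y′ n} {x m ℚ.- x′ n} (y′C n (ℕ.≤-trans N₂≤K K≤n))
            (k m n (ℕ.≤-trans N₄≤K K≤m) (ℕ.≤-trans N₄≤K K≤n)))

  infixl 6 _+_
  infixl 7 _*_
  infix  8 -_

  _+_ : ℝ → ℝ → ℝ
  x + y = mkℝ (λ n → seq x n ℚ.+ seq y n) (+-cong (cauchy x) (cauchy y))

  _*_ : ℝ → ℝ → ℝ
  x * y = mkℝ (λ n → seq x n ℚ.* seq y n) (*-cong (cauchy x) (cauchy y))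

  -_ : ℝ → ℝ
  - x = mkℝ (λ n → ℚ.- seq x n) (neg-cong (cauchy x))

  fromℚ : ℚ → ℝ
  fromℚ c = mkℝ (λ _ → c) (∼-const c)

  0ℝ 1ℝ : ℝ
  0ℝ = fromℚ 0ℚ
  1ℝ = fromℚ 1ℚ

  private
    pointwise : ∀ x y → (∀ n → seq x n ≡ seq y n) → x ≈ y
    pointwise x y eq = ∼-pointwise eq (cauchy x)

  ℝ-commutativeRing : CommutativeRing 0ℓ 0ℓ
  ℝ-commutativeRing = record
    { Carrier = ℝ ; _≈_ = _≈_ ; _+_ = _+_ ; _*_ = _*_ ; -_ = -_ ; 0# = 0ℝ ; 1# = 1ℝ
    ; isCommutativeRing = record
      { isRing = record
        { +-isAbelianGroup = record
          { isGroup = record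
            { isMonoid = record
              { isSemigroup = record
                { isMagma = record
                  { isEquivalence = record
                    { refl = λ {x} → cauchy x ; sym = ∼-sym ; trans = ∼-trans }
                  ; ∙-cong = +-cong }
                ; assoc = λ x y z → pointwise ((x + y) + z) (x + (y + z))
                    λ n → ℚ.+-assoc (seq x n) (seq y n) (seq z n) }
              ; identity = (λ x → pointwise (0ℝ + x) x λ n → ℚ.+-identityˡ (seq x n))
                         , (λ x → pointwise (x + 0ℝ) x λ n → ℚ.+-identityʳ (seq x n)) }
            ; inverse = (λ x → pointwise (- x + x) 0ℝ λ n → ℚ.+-inverseˡ (seq x n))
                      , (λ x → pointwise (x + - x) 0ℝ λ n → ℚ.+-inverseʳ (seq x n))
            ; ⁻¹-cong = neg-cong }
          ; comm = λ x y → pointwise (x + y) (y + x) λ n → ℚ.+-comm (seq x n) (seq y n) }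
        ; *-cong = *-cong
        ; *-assoc = λ x y z → pointwise ((x * y) * z) (x * (y * z))
            λ n → ℚ.*-assoc (seq x n) (seq y n) (seq z n)
        ; *-identity = (λ x → pointwise (1ℝ * x) x λ n → ℚ.*-identityˡ (seq x n))
                     , (λ x → pointwise (x * 1ℝ) x λ n → ℚ.*-identityʳ (seq x n))
        ; distrib = (λ x y z → pointwise (x * (y + z)) (x * y + x * z)
                       λ n → ℚ.*-distribˡ-+ (seq x n) (seq y n) (seq z n))
                  , (λ x y z → pointwise ((y + z) * x) (y * x + z * x)
                       λ n → ℚ.*-distribʳ-+ (seq x n) (seq y n) (seq z n)) }
      ; *-comm = λ x y → pointwise (x * y) (y * x) λ n → ℚ.*-comm (seq x n) (seq y n) }
    }

module BigOperators {c ℓ} (R : CommutativeRing c ℓ) where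
  open CommutativeRing R

  ∑ : ∀ {a} {A : Set a} → List A → (A → Carrier) → Carrier
  ∑ xs f = foldr (λ x s → f x + s) 0# xs

  ∏ : ∀ {a} {A : Set a} → List A → (A → Carrier) → Carrier
  ∏ xs f = foldr (λ x s → f x * s) 1# xs

  infix 6 ∑ ∏
  syntax ∑ xs (λ x → e) = ∑[ x ∈ xs ] e
  syntax ∏ xs (λ x → e) = ∏[ x ∈ xs ] e

open Real public using (ℝ; _≈_; _+_; _*_; 1ℝ; ℝ-commutativeRing)
open BigOperators ℝ-commutativeRing public

data Literal (n : ℕ) : Set where
  pos neg : Fin n → Literal n

-- A clause may be empty, and may contain both pos i and neg i.
record Clause (n : ℕ) : Set where
  constructor clause
  field
    literals : List (Literal n)
    distinct : Unique literals
open Clause public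

CNF : ℕ → Set
CNF n = List (Clause n)

-- nothing stands for *, just false for 0 and just true for 1.
PartialAssignment : ℕ → Set
PartialAssignment n = Vec (Maybe Bool) n

evalLiteral : ∀ {n} → PartialAssignment n → Literal n → Maybe Bool
evalLiteral x (pos i) = lookup x i
evalLiteral x (neg i) = Maybe.map not (lookup x i)

module _ {n : ℕ} (x : PartialAssignment n) where

  AllZero : Clause n → Set
  AllZero C = All (λ l → evalLiteral x l ≡ just false) (literals C)

  OneStarRestZero : Clause n → Set
  OneStarRestZero C = Any (λ l → evalLiteral x l ≡ nothing ×
    All (λ l′ → l′ ≢ l → evalLiteral x l′ ≡ just false) (literals C)) (literals C)

  InvalidForClause : Clause n → Set
  InvalidForClause C = AllZero C ⊎ OneStarRestZero C

Valid : ∀ {n} → CNF n → PartialAssignment n → Set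
Valid F x = All (λ C → ¬ InvalidForClause x C) F

_≟ˡ_ : ∀ {n} → DecidableEquality (Literal n)
pos i ≟ˡ pos j = map′ (cong pos) (λ { refl → refl }) (i ≟ᶠ j)
pos i ≟ˡ neg j = no λ ()
neg i ≟ˡ pos j = no λ ()
neg i ≟ˡ neg j = map′ (cong neg) (λ { refl → refl }) (i ≟ᶠ j)

_≟ᵛ_ : DecidableEquality (Maybe Bool)
_≟ᵛ_ = Maybe-≡-dec _≟ᵇ_

invalidForClause? : ∀ {n} (x : PartialAssignment n) → Decidable (InvalidForClause x)
invalidForClause? x C =
  All.all? (λ l → evalLiteral x l ≟ᵛ just false) (literals C)
  ⊎-dec
  Any.any? (λ l → (evalLiteral x l ≟ᵛ nothing) ×-dec
    All.all? (λ l′ → ¬? (l′ ≟ˡ l) →-dec (evalLiteral x l′ ≟ᵛ just false)) (literals C))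
    (literals C)

valid? : ∀ {n} (F : CNF n) → Decidable (Valid F)
valid? F x = All.all? (λ C → ¬? (invalidForClause? x C)) F

module _ {n : ℕ} (a : Vec Bool n) where

  MakesTrue : Literal n → Set
  MakesTrue (pos i) = lookup a i ≡ true
  MakesTrue (neg i) = lookup a i ≡ false

  Satisfies : CNF n → Set
  Satisfies F = All (λ C → Any MakesTrue (literals C)) F

total : ∀ {n} → Vec Bool n → PartialAssignment n
total = Vec.map just

private
  total-true : ∀ {n} (a : Vec Bool n) l → MakesTrue a l → evalLiteral (total a) l ≡ just true
  total-true a (pos i) eq rewrite lookup-map i just a | eq = refl
  total-true a (neg i) eq rewrite lookup-map i just a | eq = refl

  total-no-star : ∀ {n} (a : Vec Bool n) l → evalLiteral (total a) l ≢ nothing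
  total-no-star a (pos i) eq rewrite lookup-map i just a with () ← eq
  total-no-star a (neg i) eq rewrite lookup-map i just a with () ← eq

satisfies⇒valid : ∀ {n} (F : CNF n) (a : Vec Bool n) → Satisfies a F → Valid F (total a)
satisfies⇒valid F a = All.map λ {C} sat → λ where
    (inj₁ zeros) → case-zero (All.lookupAny zeros sat)
    (inj₂ star)  → let (l , eq , _) = Any.satisfied star in total-no-star a l eq
  where
  case-zero : ∀ {l} → ¬ (evalLiteral (total a) l ≡ just false × MakesTrue a l)
  case-zero {l} (eq , t) with () ← trans (sym eq) (total-true a l t)

-- Validity is stored irrelevantly, so equality in P F is equality of
-- partial assignments.
P : ∀ {n} → CNF n → Set
P {n} F = Refinement (PartialAssignment n) (Valid F)

satisfying : ∀ {n} (F : CNF n) (a : Vec Bool n) → Satisfies a F → P F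
satisfying F a sat = total a , [ satisfies⇒valid F a sat ]

unassign : ∀ {n} → PartialAssignment n → Fin n → PartialAssignment n
unassign x i = x [ i ]≔ nothing

_Covers_ : ∀ {n} {F : CNF n} → P F → P F → Set
a Covers b = ∃[ i ] Is-just (lookup (value a) i) × value b ≡ unassign (value a) i

-- The closure is taken in P F, so every intermediate assignment is valid.
infix 4 _≤_
_≤_ : ∀ {n} {F : CNF n} → P F → P F → Set
b ≤ a = Star _Covers_ a b

private
  assigned : ∀ {n} → PartialAssignment n → ℕ
  assigned []            = 0
  assigned (just _ ∷ x)  = suc (assigned x)
  assigned (nothing ∷ x) = assigned x

  unassign-< : ∀ {n} (x : PartialAssignment n) i → Is-just (lookup x i) →
               assigned (unassign x i) ℕ.< assigned x
  unassign-< (just _ ∷ x)  zero    _ = ℕ.≤-refl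
  unassign-< (just _ ∷ x)  (suc i) j = ℕ.s≤s (unassign-< x i j)
  unassign-< (nothing ∷ x) (suc i) j = unassign-< x i j

isJust? : (v : Maybe Bool) → Dec (Is-just v)
isJust? = MaybeAny.dec λ _ → yes _

_≤?_ : ∀ {n} {F : CNF n} (b a : P F) → Dec (b ≤ a)
_≤?_ {n} {F} b a = go a (<-wellFounded _)
  where
  -- b is reachable from a by a path whose first step unassigns i.
  Via : P F → Fin n → Set
  Via a i = Is-just (lookup (value a) i) ×
            Σ (P F) λ c → value c ≡ unassign (value a) i × b ≤ c

  go : ∀ a → Acc ℕ._<_ (assigned (value a)) → Dec (b ≤ a)
  via? : ∀ a → Acc ℕ._<_ (assigned (value a)) → Decidable (Via a)

  go a ac with Refinement-≟ (Vec-≡-dec _≟ᵛ_) a b | any? (via? a ac)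
  ... | yes refl | _                          = yes ε
  ... | no _     | yes (i , j , c , eq , b≤c) = yes ((i , j , eq) ◅ b≤c)
  ... | no a≢b   | no ¬via                    = no λ where
    ε                      → a≢b refl
    ((i , j , eq) ◅ b≤c) → ¬via (i , j , _ , eq , b≤c)

  via? a (acc rs) i with isJust? (lookup (value a) i) | valid? F (unassign (value a) i)
  ... | no ¬j | _     = no λ (j , _) → ¬j j
  ... | yes _ | no ¬v = no λ where
    (_ , (_ , [ v ]) , refl , _) → contradiction-irr v ¬v
  ... | yes j | yes v with go (unassign (value a) i , [ v ]) (rs (unassign-< (value a) i j))
  ...   | yes b≤c = yes (j , _ , refl , b≤c)
  ...   | no b≰c  = no λ where (_ , _ , refl , b≤c) → b≰c b≤c

partialAssignments : ∀ n → List (PartialAssignment n)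
partialAssignments zero    = [] ∷ []
partialAssignments (suc n) = cartesianProductWith _∷_
  (nothing ∷ just false ∷ just true ∷ []) (partialAssignments n)

validAssignments : ∀ {n} (F : CNF n) → List (P F)
validAssignments {n} F = mapMaybe ifValid (partialAssignments n)
  where
  ifValid : PartialAssignment n → Maybe (P F)
  ifValid x with valid? F x
  ... | yes v = just (x , [ v ])
  ... | no _  = nothing

downset : ∀ {n} {F : CNF n} → P F → List (P F)
downset {F = F} a = filter (_≤? a) (validAssignments F)

module _ {n : ℕ} {F : CNF n} (b : P F) where

  IsStar : Fin n → Set
  IsStar i = lookup (value b) i ≡ nothing

  IsUnconstrained : Fin n → Set
  IsUnconstrained i = Is-just (lookup (value b) i) × Valid F (unassign (value b) i)

  star? : Decidable IsStar
  star? i = lookup (value b) i ≟ᵛ nothing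

  unconstrained? : Decidable IsUnconstrained
  unconstrained? i = isJust? (lookup (value b) i) ×-dec valid? F (unassign (value b) i)

  S : List (Fin n)
  S = filter star? (allFin n)

  U : List (Fin n)
  U = filter unconstrained? (allFin n)

{-# OPTIONS --safe #-}

-- In P F, unassigning variables never destroys unconstrainedness: if i is
-- unconstrained in b, then every c ≤ b has i as a star or an unconstrained
-- variable, and if i is a star of c then c lies below b with i unassigned.  Hence
-- the c ≤ b split, at an unconstrained i, into those below b with i unassigned
-- (contributing the factor p i) and those keeping the value of i (contributing
-- q i).  By induction on the number of undecided variables, both parts sum to 1
-- up to these factors, and p i + q i = 1.
module Submission where

open import Defs hiding (_≈_; _+_; _*_; ∑; ∏)
open import Algebra.Bundles using (CommutativeRing)
open import Data.Bool using (Bool; true; false)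
open import Data.Fin using (Fin)
open import Data.Fin.Properties using () renaming (_≟_ to _≟ᶠ_)
open import Data.Irrelevant using ([_])
open import Data.List using (List; []; _∷_; _++_; length; filter; mapMaybe)
open import Data.List.Membership.Propositional using (_∈_; _∉_; find)
open import Data.List.Membership.Propositional.Properties
  using (∈-∃++; ∈-filter⁺; ∈-filter⁻; ∈-cartesianProductWith⁺; ∈-allFin)
open import Data.List.Properties using (filter-accept; filter-reject; filter-none; length-tabulate)
open import Data.List.Relation.Binary.Permutation.Propositional
  using (_↭_; refl; prep; swap; trans; ↭-sym; ↭⇒↭ₛ)
open import Data.List.Relation.Binary.Permutation.Propositional.Properties
  using (shift; filter-↭; All-resp-↭; ∈-resp-↭; ↭-length)
open import Data.List.Relation.Binary.Permutation.Setoid.Properties using (Unique-resp-↭)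
open import Data.List.Relation.Unary.All as All using (All; []; _∷_)
open import Data.List.Relation.Unary.All.Properties using (¬Any⇒All¬)
open import Data.List.Relation.Unary.AllPairs using ([]; _∷_)
open import Data.List.Relation.Unary.Any as Any using (Any; here; there)
open import Data.List.Relation.Unary.Unique.Propositional using (Unique)
open import Data.List.Relation.Unary.Unique.Propositional.Properties as Unique
  using (Unique[x∷xs]⇒x∉xs)
open import Data.Maybe using (Maybe; just; nothing; Is-just)
import Data.Maybe.Relation.Unary.Any as MaybeAny
open import Data.Nat using (ℕ; zero; suc)
open import Data.Nat.Properties using (suc-injective)
open import Data.Product using (Σ; ∃-syntax; _×_; _,_; proj₁; proj₂)
open import Data.Refinement using (value; value-injective; _,_)
open import Data.Sum using (_⊎_; inj₁; inj₂)
open import Data.Vec using (Vec; []; _∷_; lookup)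
open import Data.Vec.Properties
  using (∷-injective; lookup-map; lookup∘update; lookup∘update′; []≔-commutes)
open import Function using (_∘_; case_of_)
open import Relation.Binary.Construct.Closure.ReflexiveTransitive using (ε; _◅_; _◅◅_)
open import Relation.Binary.PropositionalEquality as ≡
  using (_≡_; _≢_; cong; subst)
open import Relation.Nullary using (¬_; yes; no; ¬?; recompute; contradiction)
open import Relation.Unary using (Pred; Decidable)

-- Literals, the information order on partial assignments, and invalid clauses.

var : ∀ {n} → Literal n → Fin n
var (pos i) = i
var (neg i) = i

infix 4 _⊑_
-- The order of `P F` with the validity of intermediate assignments forgotten: `x` arises from `y`
-- by turning coordinates into stars. Literal values and clause validity depend on no more than
-- this.
_⊑_ : ∀ {n} → PartialAssignment n → PartialAssignment n → Set
x ⊑ y = ∀ i {v} → lookup x i ≡ just v → lookup y i ≡ just v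

evalLiteral-mono : ∀ {n} {x y : PartialAssignment n} → x ⊑ y →
  ∀ l {v} → evalLiteral x l ≡ just v → evalLiteral y l ≡ just v
evalLiteral-mono x⊑y (pos i) eq = x⊑y i eq
evalLiteral-mono {x = x} x⊑y (neg i) eq with lookup x i in xi
... | just _ rewrite x⊑y i xi = eq

evalLiteral-cong : ∀ {n} {x y : PartialAssignment n} l →
  lookup x (var l) ≡ lookup y (var l) → evalLiteral x l ≡ evalLiteral y l
evalLiteral-cong (pos i) eq = eq
evalLiteral-cong (neg i) eq rewrite eq = ≡.refl

evalLiteral-star : ∀ {n} {x : PartialAssignment n} l →
  lookup x (var l) ≡ nothing → evalLiteral x l ≡ nothing
evalLiteral-star (pos i) eq = eq
evalLiteral-star (neg i) eq rewrite eq = ≡.refl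

nothing≢just : ∀ {a} {A : Set a} {v : A} {m : Maybe A} → m ≡ nothing → m ≢ just v
nothing≢just ≡.refl ()

Is-just⇒≢nothing : ∀ {a} {A : Set a} {m : Maybe A} → Is-just m → m ≢ nothing
Is-just⇒≢nothing () ≡.refl

≢nothing⇒Is-just : ∀ {a} {A : Set a} {m : Maybe A} → m ≢ nothing → Is-just m
≢nothing⇒Is-just {m = just _}  _  = MaybeAny.just _
≢nothing⇒Is-just {m = nothing} m≢ = contradiction ≡.refl m≢

module _ {n : ℕ} where

  unassign-star : ∀ (x : PartialAssignment n) i → lookup (unassign x i) i ≡ nothing
  unassign-star x i = lookup∘update i x nothing

  unassign-other : ∀ (x : PartialAssignment n) {i j} → j ≢ i →
    lookup (unassign x i) j ≡ lookup x j
  unassign-other x j≢i = lookup∘update′ j≢i x nothing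

  ⊑-trans : ∀ (x y z : PartialAssignment n) → x ⊑ y → y ⊑ z → x ⊑ z
  ⊑-trans _ _ _ x⊑y y⊑z i = y⊑z i ∘ x⊑y i

  ⊑-star : ∀ (x y : PartialAssignment n) → x ⊑ y →
    ∀ i → lookup y i ≡ nothing → lookup x i ≡ nothing
  ⊑-star x y x⊑y i yi with lookup x i in xi
  ... | nothing = ≡.refl
  ... | just _  = contradiction (x⊑y i xi) (nothing≢just yi)

  ⊑-nonstar : ∀ (x y : PartialAssignment n) → x ⊑ y →
    ∀ i → lookup x i ≢ nothing → lookup x i ≡ lookup y i
  ⊑-nonstar x y x⊑y i xi≢ with lookup x i in xi
  ... | nothing = contradiction ≡.refl xi≢
  ... | just _  = ≡.sym (x⊑y i xi)

  unassign-⊑ : ∀ (x : PartialAssignment n) i → unassign x i ⊑ x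
  unassign-⊑ x i j eq with j ≟ᶠ i
  ... | yes ≡.refl = contradiction eq (nothing≢just (unassign-star x i))
  ... | no j≢i     = ≡.trans (≡.sym (unassign-other x j≢i)) eq

  unassign-mono : ∀ (x y : PartialAssignment n) i → x ⊑ y → unassign x i ⊑ unassign y i
  unassign-mono x y i x⊑y j eq with j ≟ᶠ i
  ... | yes ≡.refl = contradiction eq (nothing≢just (unassign-star x i))
  ... | no j≢i     = ≡.trans (unassign-other y j≢i)
                       (x⊑y j (≡.trans (≡.sym (unassign-other x j≢i)) eq))

  -- Zeros of `unassign x i` are zeros of `x`, which settles the all-zero case. Otherwise let `l` be
  -- the only starred literal. If `l` is on `i`, it is also starred in `unassign y i`, where the
  -- other literals stay zero by monotonicity; if not, `l` was already starred in `x`.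
  invalid-unassign : ∀ {x y : PartialAssignment n} i → x ⊑ y → ∀ C →
    InvalidForClause (unassign x i) C → InvalidForClause x C ⊎ InvalidForClause (unassign y i) C
  invalid-unassign {x} {y} i x⊑y C (inj₁ zeros) =
    inj₁ (inj₁ (All.map (λ {l} → evalLiteral-mono (unassign-⊑ x i) l) zeros))
  invalid-unassign {x} {y} i x⊑y C (inj₂ star) with find star
  ... | l , l∈C , eq , rest with var l ≟ᶠ i
  ...   | yes ≡.refl = inj₂ (inj₂ (Any.map
            (λ { ≡.refl → evalLiteral-star l (unassign-star y i)
                        , All.map (λ {l′} f l′≢ → evalLiteral-mono (unassign-mono x y i x⊑y) l′ (f l′≢)) rest })
            l∈C))
  ...   | no l≢i     = inj₁ (inj₂ (Any.map
            (λ { ≡.refl → ≡.trans (evalLiteral-cong l (≡.sym (unassign-other x l≢i))) eq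
                        , All.map (λ {l′} f l′≢ → evalLiteral-mono (unassign-⊑ x i) l′ (f l′≢)) rest })
            l∈C))

  -- Contrapositive of `invalid-unassign`, clause by clause. This is why being unconstrained is
  -- inherited downwards.
  unassign-valid : ∀ (F : CNF n) {x y : PartialAssignment n} i → x ⊑ y →
    Valid F x → Valid F (unassign y i) → Valid F (unassign x i)
  unassign-valid F i x⊑y vx vy = All.zipWith
    (λ {C} (¬x , ¬y) inv → case invalid-unassign i x⊑y C inv of λ where
      (inj₁ ix) → ¬x ix
      (inj₂ iy) → ¬y iy)
    (vx , vy)

-- Unconstrained variables along the order of `P F`.

module _ {n : ℕ} {F : CNF n} where

  -- Decidability of `Valid` turns the irrelevantly stored proof into a relevant one.
  valid : (b : P F) → Valid F (value b)
  valid (x , [ v ]) = recompute (valid? F x) v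

  unassigned : (b : P F) (i : Fin n) → Valid F (unassign (value b) i) → P F
  unassigned b i v = unassign (value b) i , [ v ]

  ≤⇒⊑ : ∀ {b c : P F} → c ≤ b → value c ⊑ value b
  ≤⇒⊑ ε                                  = λ _ eq → eq
  ≤⇒⊑ {b} {c} (_◅_ {j = d} (i , _ , ≡.refl) c≤d) =
    ⊑-trans (value c) (value d) (value b) (≤⇒⊑ c≤d) (unassign-⊑ (value b) i)

  unconstrained-≤ : ∀ {b c : P F} {i} → c ≤ b → IsUnconstrained b i →
    lookup (value c) i ≢ nothing → IsUnconstrained c i
  unconstrained-≤ {b} {c} {i} c≤b (_ , v) ci =
    ≢nothing⇒Is-just ci , unassign-valid F {y = value b} i (≤⇒⊑ c≤b) (valid c) v

  unassigned-≤ : ∀ {b : P F} {i} ((_ , v) : IsUnconstrained b i) → unassigned b i v ≤ b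
  unassigned-≤ (j , _) = (_ , j , ≡.refl) ◅ ε

  -- Since `c` has a star at `i`, the path from `b` to `c` unassigns `i` at some step. That step is
  -- moved to the front: the earlier steps commute with unassigning `i`, and the assignments so
  -- produced are valid by `unassign-valid`.
  ≤-unassigned : ∀ {b c : P F} {i} → c ≤ b → ((_ , v) : IsUnconstrained b i) →
    lookup (value c) i ≡ nothing → c ≤ unassigned b i v
  ≤-unassigned ε (bi , _) ci = contradiction ci (Is-just⇒≢nothing bi)
  ≤-unassigned {b} {c} {i} (_◅_ {j = d} (j , bj , eq) c≤d) (bi , v) ci with i ≟ᶠ j
  -- The step at `i` lands on `unassigned b i v` itself, so the rest of the path is unchanged.
  ... | yes ≡.refl = subst (c ≤_) (value-injective eq) c≤d
  ... | no i≢j     =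
    (j , subst Is-just (≡.sym (unassign-other (value b) (i≢j ∘ ≡.sym))) bj , commutes)
      ◅ ≤-unassigned c≤d (di , dv) ci
    where
    di : Is-just (lookup (value d) i)
    di = subst Is-just (≡.trans (≡.sym (unassign-other (value b) i≢j))
                                (cong (λ x → lookup x i) (≡.sym eq))) bi
    d⊑b : value d ⊑ value b
    d⊑b = subst (_⊑ value b) (≡.sym eq) (unassign-⊑ (value b) j)
    dv : Valid F (unassign (value d) i)
    dv = unassign-valid F {y = value b} i d⊑b (valid d) v
    commutes : unassign (value d) i ≡ unassign (unassign (value b) i) j
    commutes = ≡.trans (cong (λ x → unassign x i) eq)
                       ([]≔-commutes (value b) j i (i≢j ∘ ≡.sym))

  -- `R` holds the undecided variables. The induction sums over the `c ≤ b` that satisfy this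
  -- condition.
  FixedOff : List (Fin n) → P F → P F → Set
  FixedOff R b c = ∀ {i} → i ∉ R → lookup (value c) i ≡ lookup (value b) i

  -- The first step of a nonempty path unassigns some `j` and reaches a valid assignment, so `j` is
  -- unconstrained in `b` and lies outside `R`. But the star at `j` persists down to `c`, against
  -- agreement with `b` off `R`.
  FixedOff-minimal : ∀ {R} {b c : P F} → All (λ i → ¬ IsUnconstrained b i) R →
    c ≤ b → FixedOff R b c → c ≡ b
  FixedOff-minimal _ ε _ = ≡.refl
  FixedOff-minimal {R} {b} {c} none (_◅_ {j = d} (j , bj , eq) c≤d) fixed =
    contradiction (≡.trans (≡.sym (fixed j∉R)) cj) (Is-just⇒≢nothing bj)
    where
    j∉R : j ∉ R
    j∉R j∈R = All.lookup none j∈R (bj , subst (Valid F) eq (valid d))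
    cj : lookup (value c) j ≡ nothing
    cj = ⊑-star (value c) (value d) (≤⇒⊑ c≤d) j
           (≡.trans (cong (λ x → lookup x j) eq) (unassign-star (value b) j))

-- The list `downset a` contains each element below `a` exactly once.

partialAssignments-complete : ∀ {n} (x : PartialAssignment n) → x ∈ partialAssignments n
partialAssignments-complete []      = here ≡.refl
partialAssignments-complete (v ∷ x) =
  ∈-cartesianProductWith⁺ _∷_ (v∈ v) (partialAssignments-complete x)
  where
  v∈ : ∀ v → v ∈ nothing ∷ just false ∷ just true ∷ []
  v∈ nothing      = here ≡.refl
  v∈ (just false) = there (here ≡.refl)
  v∈ (just true)  = there (there (here ≡.refl))

partialAssignments-unique : ∀ n → Unique (partialAssignments n)
partialAssignments-unique zero    = [] ∷ []
partialAssignments-unique (suc n) = Unique.cartesianProductWith⁺ _∷_ ∷-injective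
  (((λ ()) ∷ (λ ()) ∷ []) ∷ ((λ ()) ∷ []) ∷ [] ∷ []) (partialAssignments-unique n)

module _ {n : ℕ} (F : CNF n) where

  -- Unification names the where-bound function of validAssignments.
  ifValid : Σ (PartialAssignment n → Maybe (P F))
              λ f → validAssignments F ≡ mapMaybe f (partialAssignments n)
  ifValid = _ , ≡.refl

  ∈-ifValid⁻ : ∀ xs {b} → b ∈ mapMaybe (proj₁ ifValid) xs → value b ∈ xs
  ∈-ifValid⁻ (x ∷ xs) b∈ with valid? F x | b∈
  ... | yes _ | here ≡.refl = here ≡.refl
  ... | yes _ | there b∈xs  = there (∈-ifValid⁻ xs b∈xs)
  ... | no _  | b∈xs        = there (∈-ifValid⁻ xs b∈xs)

  ∈-ifValid⁺ : ∀ {xs} (b : P F) → value b ∈ xs → b ∈ mapMaybe (proj₁ ifValid) xs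
  ∈-ifValid⁺ {x ∷ _} b b∈ with valid? F x | b∈
  ... | yes _ | here ≡.refl = here ≡.refl
  ... | yes _ | there b∈xs  = there (∈-ifValid⁺ b b∈xs)
  ... | no ¬v | here ≡.refl = contradiction (valid b) ¬v
  ... | no _  | there b∈xs  = ∈-ifValid⁺ b b∈xs

  ifValid-unique : ∀ {xs} → Unique xs → Unique (mapMaybe (proj₁ ifValid) xs)
  ifValid-unique []                     = []
  ifValid-unique {x ∷ xs} u@(_ ∷ uniq) with valid? F x
  -- A second copy of the head would put its value `x` into `xs` again.
  ... | yes v = All.tabulate (λ { b∈ ≡.refl → Unique[x∷xs]⇒x∉xs u (∈-ifValid⁻ xs b∈) })
                ∷ ifValid-unique uniq
  ... | no _  = ifValid-unique uniq

module _ {n : ℕ} {F : CNF n} (a : P F) where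

  downset-unique : Unique (downset a)
  downset-unique = Unique.filter⁺ (_≤? a) (ifValid-unique F (partialAssignments-unique n))

  ∈-downset⁺ : ∀ {b} → b ≤ a → b ∈ downset a
  ∈-downset⁺ {b} = ∈-filter⁺ (_≤? a) (∈-ifValid⁺ F b (partialAssignments-complete (value b)))

  ∈-downset⁻ : ∀ {b} → b ∈ downset a → b ≤ a
  ∈-downset⁻ = proj₂ ∘ ∈-filter⁻ (_≤? a) {xs = validAssignments F}

-- Singletons and permutations of lists.

module _ {a} {A : Set a} where

  unique-constant : ∀ {xs} {x : A} → Unique xs → x ∈ xs → (∀ {y} → y ∈ xs → y ≡ x) → xs ≡ x ∷ []
  unique-constant {y ∷ []}     _                 _ const with ≡.refl ← const (here ≡.refl) = ≡.refl
  unique-constant {y ∷ z ∷ xs} ((y≢z ∷ _) ∷ _) _ const =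
    contradiction (≡.trans (const (here ≡.refl)) (≡.sym (const (there (here ≡.refl))))) y≢z

  ∈⇒↭∷ : ∀ {xs} {x : A} → x ∈ xs → ∃[ ys ] xs ↭ x ∷ ys
  ∈⇒↭∷ {x = x} x∈xs with ∈-∃++ x∈xs
  ... | ys , zs , ≡.refl = ys ++ zs , shift x ys zs

-- Finite sums and products in a commutative ring.

module BigOperatorProperties {c ℓ} (R : CommutativeRing c ℓ) {a} {A : Set a} where
  open CommutativeRing R renaming (refl to ≈-refl; sym to ≈-sym; trans to ≈-trans)
  open BigOperators R
  open import Algebra.Properties.CommutativeSemigroup +-commutativeSemigroup
    using () renaming (x∙yz≈y∙xz to x+yz≈y+xz)
  open import Algebra.Properties.CommutativeSemigroup *-commutativeSemigroup
    using () renaming (x∙yz≈y∙xz to x*yz≈y*xz)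

  ∏-↭ : ∀ {xs ys : List A} (f : A → Carrier) → xs ↭ ys → ∏ xs f ≈ ∏ ys f
  ∏-↭ f refl         = ≈-refl
  ∏-↭ f (prep x p)   = *-congˡ (∏-↭ f p)
  ∏-↭ f (swap x y p) = ≈-trans (*-congˡ (*-congˡ (∏-↭ f p))) (x*yz≈y*xz _ _ _)
  ∏-↭ f (trans p q)  = ≈-trans (∏-↭ f p) (∏-↭ f q)

  ∑-cong : ∀ (xs : List A) {f g : A → Carrier} → (∀ x → f x ≈ g x) → ∑ xs f ≈ ∑ xs g
  ∑-cong []       eq = ≈-refl
  ∑-cong (x ∷ xs) eq = +-cong (eq x) (∑-cong xs eq)

  ∑-cong-* : ∀ (xs : List A) {f g : A → Carrier} k → (∀ {x} → x ∈ xs → f x ≈ k * g x) →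
    ∑ xs f ≈ k * ∑ xs g
  ∑-cong-* []       k eq = ≈-sym (zeroʳ k)
  ∑-cong-* (x ∷ xs) k eq = ≈-trans
    (+-cong (eq (here ≡.refl)) (∑-cong-* xs k (eq ∘ there)))
    (≈-sym (distribˡ k _ _))

  ∑-partition : ∀ {p} {Q : Pred A p} (Q? : Decidable Q) (xs : List A) (f : A → Carrier) →
    ∑ xs f ≈ ∑ (filter Q? xs) f + ∑ (filter (¬? ∘ Q?) xs) f
  ∑-partition Q? []       f = ≈-sym (+-identityˡ 0#)
  ∑-partition Q? (x ∷ xs) f with Q? x
  ... | yes _ = ≈-trans (+-congˡ (∑-partition Q? xs f))
                  (≈-sym (+-assoc _ _ _))
  ... | no _  = ≈-trans (+-congˡ (∑-partition Q? xs f)) (x+yz≈y+xz _ _ _)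

-- The induction on undecided variables, over any commutative ring.

module _ {c ℓ} (𝓡 : CommutativeRing c ℓ) {n : ℕ} {F : CNF n} where
  open CommutativeRing 𝓡 renaming (refl to ≈-refl; sym to ≈-sym; trans to ≈-trans)
  open BigOperators 𝓡
  open BigOperatorProperties 𝓡
  open import Algebra.Properties.CommutativeSemigroup *-commutativeSemigroup
    using (x∙yz≈y∙xz)
  open import Relation.Binary.Reasoning.Setoid setoid

  module _ (p q : Fin n → Carrier) (p+q≈1 : ∀ i → p i + q i ≈ 1#) where

    -- The summand restricted to the variables in `R`, so that one variable at a time can be split
    -- off; for `R` the list of all variables it is the full summand.
    weight : List (Fin n) → P F → Carrier
    weight R b = ∏ (filter (star? b) R) p * ∏ (filter (unconstrained? b) R) q

    weight-↭ : ∀ {R R′} b → R ↭ R′ → weight R b ≈ weight R′ b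
    weight-↭ b R↭ = *-cong (∏-↭ p (filter-↭ (star? b) R↭)) (∏-↭ q (filter-↭ (unconstrained? b) R↭))

    weight-star : ∀ {R b i} → IsStar b i → weight (i ∷ R) b ≈ p i * weight R b
    weight-star {R} {b} {i} bi
      rewrite filter-accept (star? b) {xs = R} bi
            | filter-reject (unconstrained? b) {xs = R} (λ (j , _) → Is-just⇒≢nothing j bi)
      = *-assoc _ _ _

    weight-unconstrained : ∀ {R b i} → IsUnconstrained b i → weight (i ∷ R) b ≈ q i * weight R b
    weight-unconstrained {R} {b} {i} u
      rewrite filter-reject (star? b) {xs = R} (Is-just⇒≢nothing (proj₁ u))
            | filter-accept (unconstrained? b) {xs = R} u
      = x∙yz≈y∙xz _ _ _

    weight-constrained : ∀ {R b} → All (λ i → ¬ IsStar b i) R →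
      All (λ i → ¬ IsUnconstrained b i) R → weight R b ≈ 1#
    weight-constrained {b = b} ¬S ¬U
      rewrite filter-none (star? b) ¬S | filter-none (unconstrained? b) ¬U = *-identityˡ 1#

    -- A specification instead of a fixed list, because filtering `L` by the star status of a
    -- variable then yields another instance with fewer undecided variables.
    record Enumerates (L : List (P F)) (b : P F) (R : List (Fin n)) : Set where
      field
        unique   : Unique L
        complete : ∀ {c} → c ≤ b → FixedOff R b c → c ∈ L
        sound    : ∀ {c} → c ∈ L → c ≤ b × FixedOff R b c
    open Enumerates

    module _ {L : List (P F)} {b : P F} {i : Fin n} {R : List (Fin n)}
             (enum : Enumerates L b (i ∷ R)) (unc : IsUnconstrained b i) where

      -- `≤-unassigned` and `unassigned-≤` identify the elements with a star at `i` with those below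
      -- the new base point. It has a star at `i` too, so `i` joins the fixed variables.
      enumerates-star : Enumerates (filter (λ c → star? c i) L) (unassigned b i (proj₂ unc)) R
      enumerates-star .unique = Unique.filter⁺ (λ c → star? c i) (unique enum)
      enumerates-star .complete {c} c≤b′ fixed =
        ∈-filter⁺ (λ c → star? c i)
          (complete enum (unassigned-≤ unc ◅◅ c≤b′) λ {j} j∉ →
            ≡.trans (fixed (j∉ ∘ there)) (unassign-other (value b) (j∉ ∘ here)))
          (⊑-star (value c) (unassign (value b) i) (≤⇒⊑ c≤b′) i (unassign-star (value b) i))
      enumerates-star .sound {c} c∈ with ∈-filter⁻ (λ c → star? c i) {xs = L} c∈
      ... | c∈L , ci with sound enum c∈L
      ...   | c≤b , fixed = ≤-unassigned c≤b unc ci , fixed′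
        where
        fixed′ : FixedOff R (unassigned b i (proj₂ unc)) c
        fixed′ {j} j∉R with j ≟ᶠ i
        ... | yes ≡.refl = ≡.trans ci (≡.sym (unassign-star (value b) i))
        ... | no j≢i     = ≡.trans (fixed λ { (here j≡i) → j≢i j≡i ; (there j∈R) → j∉R j∈R })
                             (≡.sym (unassign-other (value b) j≢i))

      -- An element below `b` that has a value at `i` has the value of `b` there, so `i` joins the
      -- fixed variables with `b` unchanged.
      enumerates-nonstar : i ∉ R → Enumerates (filter (λ c → ¬? (star? c i)) L) b R
      enumerates-nonstar i∉R .unique = Unique.filter⁺ (λ c → ¬? (star? c i)) (unique enum)
      enumerates-nonstar i∉R .complete c≤b fixed =
        ∈-filter⁺ (λ c → ¬? (star? c i)) (complete enum c≤b (λ j∉ → fixed (j∉ ∘ there)))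
          (λ ci → Is-just⇒≢nothing (proj₁ unc) (≡.trans (≡.sym (fixed i∉R)) ci))
      enumerates-nonstar i∉R .sound {c} c∈ with ∈-filter⁻ (λ c → ¬? (star? c i)) {xs = L} c∈
      ... | c∈L , ci with sound enum c∈L
      ...   | c≤b , fixed = c≤b , fixed′
        where
        fixed′ : FixedOff R b c
        fixed′ {j} j∉R with j ≟ᶠ i
        ... | yes ≡.refl = ⊑-nonstar (value c) (value b) (≤⇒⊑ c≤b) i ci
        ... | no j≢i     = fixed λ { (here j≡i) → j≢i j≡i ; (there j∈R) → j∉R j∈R }

    enumerates-↭ : ∀ {L b R R′} → R ↭ R′ → Enumerates L b R → Enumerates L b R′
    enumerates-↭ R↭ enum .unique = unique enum
    enumerates-↭ R↭ enum .complete c≤b fixed =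
      complete enum c≤b λ i∉R → fixed (i∉R ∘ ∈-resp-↭ (↭-sym R↭))
    enumerates-↭ R↭ enum .sound c∈L with sound enum c∈L
    ... | c≤b , fixed = c≤b , λ i∉R′ → fixed (i∉R′ ∘ ∈-resp-↭ R↭)

    -- Induction on the length `k` of `R`, kept as a separate number because `R` is permuted to
    -- bring an unconstrained variable to the front.
    ∑-weight : ∀ k {L b R} → length R ≡ k → Unique R → All (λ i → ¬ IsStar b i) R →
      Enumerates L b R → ∑ L (weight R) ≈ 1#

    ∑-weight-∷ : ∀ k {L b i R} → length (i ∷ R) ≡ k → Unique (i ∷ R) →
      All (λ j → ¬ IsStar b j) (i ∷ R) → IsUnconstrained b i →
      Enumerates L b (i ∷ R) → ∑ L (weight (i ∷ R)) ≈ 1#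

    ∑-weight k {L} {b} {R} len uniq nonstar enum with Any.any? (unconstrained? b) R
    -- No variable of `R` is unconstrained, so `L` consists of `b` alone, and both products in its
    -- weight are empty.
    ... | no none rewrite unique-constant (unique enum) (complete enum ε (λ _ → ≡.refl))
                            (λ c∈L → let (c≤b , fixed) = sound enum c∈L
                                     in FixedOff-minimal (¬Any⇒All¬ R none) c≤b fixed) =
      ≈-trans (+-identityʳ _) (weight-constrained {b = b} nonstar (¬Any⇒All¬ R none))
    ... | yes some with find some
    ...   | i , i∈R , unc with ∈⇒↭∷ i∈R
    ...     | R′ , R↭ = begin
      ∑ L (weight R)         ≈⟨ ∑-cong L (λ c → weight-↭ c R↭) ⟩
      ∑ L (weight (i ∷ R′))  ≈⟨ ∑-weight-∷ k (≡.trans (≡.sym (↭-length R↭)) len)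
                                  (Unique-resp-↭ (≡.setoid (Fin n)) (↭⇒↭ₛ R↭) uniq)
                                  (All-resp-↭ R↭ nonstar) unc (enumerates-↭ R↭ enum) ⟩
      1#                     ∎

    ∑-weight-∷ (suc k) {L} {b} {i} {R} len uniq@(_ ∷ uniqR) (_ ∷ nonstar) unc enum = begin
      ∑ L (weight (i ∷ R))
        ≈⟨ ∑-partition (λ c → star? c i) L _ ⟩
      ∑ L₁ (weight (i ∷ R)) + ∑ L₂ (weight (i ∷ R))
        ≈⟨ +-cong (∑-cong-* L₁ (p i) L₁-weight) (∑-cong-* L₂ (q i) L₂-weight) ⟩
      p i * ∑ L₁ (weight R) + q i * ∑ L₂ (weight R)
        -- The base point is `b` with `i` unassigned for `L₁`, and `b` itself for `L₂`.
        ≈⟨ +-cong (*-congˡ (∑-weight k (suc-injective len) uniqR nonstar′ (enumerates-star enum unc)))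
                  (*-congˡ (∑-weight k (suc-injective len) uniqR nonstar
                                     (enumerates-nonstar enum unc i∉R))) ⟩
      p i * 1# + q i * 1#
        ≈⟨ +-cong (*-identityʳ _) (*-identityʳ _) ⟩
      p i + q i
        ≈⟨ p+q≈1 i ⟩
      1# ∎
      where
      L₁ = filter (λ c → star? c i) L
      L₂ = filter (λ c → ¬? (star? c i)) L
      i∉R : i ∉ R
      i∉R = Unique[x∷xs]⇒x∉xs uniq
      nonstar′ : All (λ j → ¬ IsStar (unassigned b i (proj₂ unc)) j) R
      nonstar′ = All.tabulate λ {j} j∈R j* → All.lookup nonstar j∈R
        (≡.trans (≡.sym (unassign-other (value b) λ { ≡.refl → i∉R j∈R })) j*)
      L₁-weight : ∀ {c} → c ∈ L₁ → weight (i ∷ R) c ≈ p i * weight R c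
      L₁-weight {c} c∈ = weight-star {b = c} (proj₂ (∈-filter⁻ (λ c → star? c i) {xs = L} c∈))
      L₂-weight : ∀ {c} → c ∈ L₂ → weight (i ∷ R) c ≈ q i * weight R c
      L₂-weight {c} c∈ with ∈-filter⁻ (λ c → ¬? (star? c i)) {xs = L} c∈
      -- `c` keeps a value at `i`, so it inherits from `b` that `i` is unconstrained.
      ... | c∈L , ci = weight-unconstrained {b = c}
                         (unconstrained-≤ {b = b} (proj₁ (sound enum c∈L)) unc ci)

    -- Start of the induction: with all variables undecided, `FixedOff` is vacuous and the whole
    -- down-set is enumerated. The summand and its factors are given only up to `≈`.
    ∑-downset : ∀ (a : P F) → (∀ i → ¬ IsStar a i) → ∀ {u v w : P F → Carrier} →
      (∀ b → w b ≈ u b * v b) → (∀ b → u b ≈ ∏ (S b) p) → (∀ b → v b ≈ ∏ (U b) q) →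
      ∑ (downset a) w ≈ 1#
    ∑-downset a nonstar w≈ u≈ v≈ = ≈-trans
      (∑-cong (downset a) (λ b → ≈-trans (w≈ b) (*-cong (u≈ b) (v≈ b))))
      (∑-weight n (length-tabulate (λ i → i)) (Unique.allFin⁺ n)
        (All.tabulate λ {i} _ → nonstar i) record
          { unique   = downset-unique a
          ; complete = λ c≤a _ → ∈-downset⁺ a c≤a
          ; sound    = λ c∈ → ∈-downset⁻ a c∈ , λ {i} i∉ → contradiction (∈-allFin i) i∉ })

-- Specialization to the real numbers.

open import Defs using (_≈_; _+_; _*_; ∑; ∏)

-- The factors u and v of the summand are inferred from the types of these
-- records: written out as terms, they would not be syntactically equal to those
-- of the theorem, and comparing products of reals by unfolding is infeasible.
record IsProduct {n : ℕ} {F : CNF n} (s : P F → List (Fin n)) (f : Fin n → ℝ)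
                 (u : P F → ℝ) : Set where
  field
    is-product : ∀ b → u b ≈ ∏ (s b) f
open IsProduct

∑-downset-ℝ : ∀ {n} {F : CNF n} {p q : Fin n → ℝ} → (∀ i → p i + q i ≈ 1ℝ) →
  ∀ (a : P F) → (∀ i → ¬ IsStar a i) → ∀ {u v : P F → ℝ} →
  IsProduct S p u → IsProduct U q v → ∑ (downset a) (λ b → u b * v b) ≈ 1ℝ
∑-downset-ℝ {F = F} {p} {q} p+q≈1 a nonstar {u} {v} u-prod v-prod =
  ∑-downset ℝ-commutativeRing {F = F} p q p+q≈1 a nonstar {u} {v} {λ b → u b * v b}
    -- Reflexivity of `≈` at a real is its Cauchy property.
    (λ b → Real.ℝ.cauchy (u b * v b)) (is-product u-prod) (is-product v-prod)

theorem4p4 : (n : ℕ) (F : CNF n) (p q : Fin n → ℝ) → (∀ i → p i + q i ≈ 1ℝ) →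
    (a : Vec Bool n) (sat : Satisfies a F) →
    ∑[ b ∈ downset (satisfying F a sat) ] ((∏[ i ∈ S b ] p i) * (∏[ j ∈ U b ] q j)) ≈ 1ℝ
theorem4p4 n F p q p+q≈1 a sat =
  let eq = ∑-downset-ℝ {n} {F} {p} {q} p+q≈1 (satisfying F a sat)
             (λ i a* → contradiction (lookup-map i just a) (nothing≢just a*))
             S-product U-product
  in eq
  where
  S-product : IsProduct {n} {F} S p (λ b → ∏ (S b) p)
  S-product .is-product b = Real.ℝ.cauchy (∏ (S b) p)
  U-product : IsProduct {n} {F} U q (λ b → ∏ (U b) q)
  U-product .is-product b = Real.ℝ.cauchy (∏ (U b) q)
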